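{- Let $n \ge 1$ be an integer. If the game of size $n$ has a non-trivial kernel (that is, there exists a non-empty null sequence for the game of size $n$), then for every integer $j \ge 1$ the game of size $n + (n+2)j$ also has a non-trivial kernel.
   Context: For an integer $n\ge 1$, the (triangular Lights Out) game of size $n$ is played on a triangular arrangement of $\beta = n(n+1)/2$ circles ("buttons") with side length $n$: row $r$ ($1\le r\le n$, from top to bottom) contains $r$ buttons, and circles touch as in the usual triangular packing. In coordinates, the buttons are the pairs $(r,s)$ with $1\le s\le r\le n$, and the neighbors of $(r,s)$ (the circles tangent to it) are those among $(r,s-1),(r,s+1),(r-1,s-1),(r-1,s),(r+1,s),(r+1,s+1)$ that belong to the arrangement. Each button is either lit or unlit; a configuration is identified with the set $C$ of lit buttons. Pressing a button switches the state of that button and of all of its neighbors. Since the order of presses is irrelevant and pressing a button twice has no effect, a move is described by a set $X$ of buttons, each pressed once; $C \xrightarrow{X} D$ means that pressing the buttons of $X$ starting from configuration $C$ yields configuration $D$. A set of buttons $X$ is a null sequence if $C \xrightarrow{X} C$ for every configuration $C$ (equivalently, for every button $b$, the number of elements of $X$ that are equal to $b$ or are neighbors of $b$ is even). The kernel of the game is the set of all null sequences; it always contains $\emptyset$, and it is called non-trivial if it contains a non-empty set. -}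

module Defs where

open import Data.Bool.Base using (Bool; true; not; if_then_else_)
open import Data.Fin.Base using (Fin; toℕ)
import Data.Fin.Properties as Fin
open import Data.List.Base using (List; []; _∷_; allFin; concatMap; filterᵇ; foldl; map)
open import Data.List.Membership.Propositional using (_∈_)
import Data.List.Membership.DecPropositional as DecMembership
open import Data.Nat.Base using (ℕ; suc; _+_; _∸_)
import Data.Nat.Properties as ℕ
open import Data.Product.Base using (Σ; ∃-syntax; _×_; _,_)
open import Data.Product.Properties using (≡-dec)
open import Data.Sum.Base using (_⊎_)
open import Relation.Binary.Definitions using (Decidable; DecidableEquality)
open import Relation.Binary.PropositionalEquality using (_≡_; _≗_)
open import Relation.Nullary.Decidable using (does; _⊎-dec_)

private
  variable
    n : ℕ

-- The pair (i , j) stands for the button in row r = i + 1 and position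
-- s = j + 1 of that row, so that 1 ≤ s ≤ r ≤ n.
Button : ℕ → Set
Button n = Σ (Fin n) λ i → Fin (suc (toℕ i))

coords : Button n → ℕ × ℕ
coords (i , j) = suc (toℕ i) , suc (toℕ j)

-- Only applied to coordinates r , s ≥ 1, where ∸ is exact.  The result may
-- contain points outside the arrangement.
adjacentCoords : ℕ × ℕ → List (ℕ × ℕ)
adjacentCoords (r , s) =
  (r     , s ∸ 1) ∷ (r     , s + 1) ∷
  (r ∸ 1 , s ∸ 1) ∷ (r ∸ 1 , s    ) ∷
  (r + 1 , s    ) ∷ (r + 1 , s + 1) ∷ []

IsNeighbor : Button n → Button n → Set
IsNeighbor b c = coords c ∈ adjacentCoords (coords b)

Affects : Button n → Button n → Set
Affects b c = c ≡ b ⊎ IsNeighbor b c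

_≟-button_ : DecidableEquality (Button n)
_≟-button_ = ≡-dec Fin._≟_ Fin._≟_

isNeighbor? : Decidable (IsNeighbor {n})
isNeighbor? b c = coords c ∈? adjacentCoords (coords b)
  where open DecMembership (≡-dec ℕ._≟_ ℕ._≟_) using (_∈?_)

affects? : Decidable (Affects {n})
affects? b c = (c ≟-button b) ⊎-dec isNeighbor? b c

-- Sets of buttons are given by characteristic functions, and compared
-- pointwise.
ButtonSet : ℕ → Set
ButtonSet n = Button n → Bool

Configuration : ℕ → Set
Configuration = ButtonSet

press : Configuration n → Button n → Configuration n
press C b c = if does (affects? b c) then not (C c) else C c

allButtons : ∀ n → List (Button n)
allButtons n = concatMap (λ i → map (i ,_) (allFin (suc (toℕ i)))) (allFin n)

pressAll : ButtonSet n → Configuration n → Configuration n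
pressAll {n} X C = foldl press C (filterᵇ X (allButtons n))

infix 4 _⟶[_]_

_⟶[_]_ : Configuration n → ButtonSet n → Configuration n → Set
C ⟶[ X ] D = pressAll X C ≗ D

NonEmpty : ButtonSet n → Set
NonEmpty X = ∃[ b ] X b ≡ true

IsNullSequence : ButtonSet n → Set
IsNullSequence X = ∀ C → C ⟶[ X ] C

NonTrivialKernel : ℕ → Set
NonTrivialKernel n = Σ (ButtonSet n) λ X → IsNullSequence X × NonEmpty X

{-# OPTIONS --safe #-}
-- Place the triangle of size n so that its surrounding lines of virtual (unlit)
-- buttons are u = 0, v = 0 and u + v = n + 2; X is a null sequence when its
-- extension by zero sums to 0 over every hexagon centred inside the triangle.
-- Reflecting repeatedly across these lines extends X to the whole lattice: at a
-- point on a mirror line the hexagon sum vanishes because mirror images cancel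
-- in pairs.  The extension F vanishes on all the lines u, v, u + v ≡ 0 modulo
-- n + 2, so it restricts to a null sequence of the triangle bounded by u = 0,
-- v = 0 and u + v = (n + 2)(j + 1), which has size n + (n + 2) j.
module Submission where

open import Defs
open import Data.Bool.Base using (Bool; true; false; not; _∧_; _xor_)
open import Data.Bool.Properties
  using (not-involutive; ∧-identityʳ; ∧-zeroʳ; ∧-distribˡ-xor; xor-identityʳ)
import Data.Bool.Solver as Bool
open import Data.Empty using (⊥-elim)
open import Data.Fin.Base using (Fin; toℕ; fromℕ<)
open import Data.Fin.Properties using (toℕ-injective; toℕ<n; toℕ-fromℕ<)
open import Data.List.Base using (List; []; _∷_; allFin; filterᵇ; foldl; map)
open import Data.List.Membership.Propositional using (_∈_)
open import Data.List.Membership.Propositional.Properties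
  using (∈-concat⁺′; ∈-map⁺; ∈-map⁻; ∈-allFin)
import Data.List.Membership.DecPropositional as DecMembership
open import Data.List.Relation.Binary.Disjoint.Propositional using (Disjoint)
open import Data.List.Relation.Unary.All using (lookup)
import Data.List.Relation.Unary.All.Properties as All
open import Data.List.Relation.Unary.AllPairs using (_∷_)
import Data.List.Relation.Unary.AllPairs.Properties as AllPairs
open import Data.List.Relation.Unary.Any using (here; there)
open import Data.List.Relation.Unary.Unique.Propositional using (Unique)
import Data.List.Relation.Unary.Unique.Propositional.Properties as Unique
open import Data.List.Relation.Unary.Unique.DecPropositional using (unique?)
open import Data.Nat.Base
  using (ℕ; zero; suc; pred; _+_; _*_; _∸_; _/_; _%_; _≤_; _<_; z≤n; s≤s; s≤s⁻¹; NonZero)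
open import Data.Nat.Divisibility using (_∣_; divides; n∣m*n; m%n≡0⇔n∣m)
open import Data.Nat.DivMod
open import Data.Nat.Properties
open import Data.Nat.Tactic.RingSolver using (solve-∀)
open import Data.Product.Base using (∃-syntax; _×_; _,_; proj₁; proj₂)
open import Data.Product.Properties using (≡-dec; ,-injective)
open import Data.Sum.Base using (inj₁; inj₂)
open import Function.Base using (_∘_)
open import Function.Bundles using (Equivalence; _⇔_; mk⇔)
open import Relation.Binary.Definitions using (DecidableEquality; tri<; tri≈; tri>)
open import Relation.Binary.PropositionalEquality
open import Relation.Nullary.Decidable
  using (does; yes; no; dec-true; dec-false; does-⇔; from-yes)

private
  variable
    A B : Set
    n : ℕ

-- Sums modulo 2 and the effect of presses

⨁ : List A → (A → Bool) → Bool
⨁ []       f = false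
⨁ (x ∷ xs) f = f x xor ⨁ xs f

⨁-cong : ∀ (xs : List A) {f g : A → Bool} → f ≗ g → ⨁ xs f ≡ ⨁ xs g
⨁-cong []       f≗g = refl
⨁-cong (x ∷ xs) f≗g = cong₂ _xor_ (f≗g x) (⨁-cong xs f≗g)

⨁-zero : ∀ (xs : List A) {f : A → Bool} → (∀ {x} → x ∈ xs → f x ≡ false) → ⨁ xs f ≡ false
⨁-zero []       f≡0 = refl
⨁-zero (x ∷ xs) f≡0 = cong₂ _xor_ (f≡0 (here refl)) (⨁-zero xs (f≡0 ∘ there))

⨁-single : ∀ {xs : List A} {x} {f : A → Bool} → Unique xs → x ∈ xs →
           (∀ {y} → y ≢ x → f y ≡ false) → ⨁ xs f ≡ f x
⨁-single {xs = x ∷ xs} {f = f} (x∉xs ∷ _) (here refl) f≡0 =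
  trans (cong (f x xor_) (⨁-zero xs λ y∈xs → f≡0 (lookup x∉xs y∈xs ∘ sym)))
        (xor-identityʳ (f x))
⨁-single (y∉xs ∷ xs!) (there x∈xs) f≡0 =
  cong₂ _xor_ (f≡0 (lookup y∉xs x∈xs)) (⨁-single xs! x∈xs f≡0)

⨁-xor : ∀ (xs : List A) (f g : A → Bool) → ⨁ xs (λ x → f x xor g x) ≡ ⨁ xs f xor ⨁ xs g
⨁-xor []       f g = refl
⨁-xor (x ∷ xs) f g rewrite ⨁-xor xs f g =
  solve 4 (λ a b c d → (a :+ b) :+ (c :+ d) := (a :+ c) :+ (b :+ d)) refl
    (f x) (g x) (⨁ xs f) (⨁ xs g)
  where open Bool.xor-∧-Solver

∧-distribˡ-⨁ : ∀ a (xs : List A) (f : A → Bool) → a ∧ ⨁ xs f ≡ ⨁ xs (λ x → a ∧ f x)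
∧-distribˡ-⨁ a []       f = ∧-zeroʳ a
∧-distribˡ-⨁ a (x ∷ xs) f =
  trans (∧-distribˡ-xor a (f x) (⨁ xs f)) (cong ((a ∧ f x) xor_) (∧-distribˡ-⨁ a xs f))

⨁-swap : ∀ (xs : List A) (ys : List B) (f : A → B → Bool) →
         ⨁ xs (λ x → ⨁ ys (f x)) ≡ ⨁ ys (λ y → ⨁ xs (λ x → f x y))
⨁-swap []       ys f = sym (⨁-zero ys λ _ → refl)
⨁-swap (x ∷ xs) ys f =
  trans (cong (⨁ ys (f x) xor_) (⨁-swap xs ys f))
        (sym (⨁-xor ys (f x) (λ y → ⨁ xs (λ x′ → f x′ y))))

module _ (_≟′_ : DecidableEquality A) where
  open DecMembership _≟′_ using (_∈?_)

  -- Repeated entries would cancel modulo 2; without repetitions at most one term of the sum is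
  -- nonzero.
  ⨁-∈? : ∀ {xs} → Unique xs → ∀ y → ⨁ xs (λ x → does (y ≟′ x)) ≡ does (y ∈? xs)
  ⨁-∈? {xs} xs! y with y ∈? xs
  ... | yes y∈xs = trans (⨁-single xs! y∈xs λ x≢y → dec-false (y ≟′ _) (x≢y ∘ sym))
                         (dec-true (y ≟′ y) refl)
  ... | no  y∉xs = ⨁-zero xs λ x∈xs → dec-false (y ≟′ _) λ { refl → y∉xs x∈xs }

-- Each press adds the indicator of `Affects b c` to the state of `c`, so the change does not depend
-- on `C`.
pressAll-⨁ : ∀ (X : ButtonSet n) C c →
             pressAll X C c ≡ C c xor ⨁ (allButtons n) (λ b → X b ∧ does (affects? b c))
pressAll-⨁ {n} X C c = go (allButtons n) C
  where
  go : ∀ bs C → foldl press C (filterᵇ X bs) c ≡ C c xor ⨁ bs (λ b → X b ∧ does (affects? b c))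
  go []       C = sym (xor-identityʳ (C c))
  go (b ∷ bs) C with X b
  ... | false = go bs C
  ... | true  with does (affects? b c) | go bs (press C b)
  ...   | false | ih = ih
  ...   | true  | ih = trans ih (shift (C c) _)
    where
    shift : ∀ a s → not a xor s ≡ a xor not s
    shift true  s = sym (not-involutive s)
    shift false s = refl

-- Buttons and their coordinates

_≟-coords_ : DecidableEquality (ℕ × ℕ)
_≟-coords_ = ≡-dec _≟_ _≟_

open DecMembership _≟-coords_ using (_∈?_)

coords-injective : ∀ (b c : Button n) → coords b ≡ coords c → b ≡ c
coords-injective (i , j) (i′ , j′) eq with ,-injective eq
... | eqᵢ , eqⱼ with toℕ-injective (suc-injective eqᵢ)
...   | refl with toℕ-injective (suc-injective eqⱼ)
...     | refl = refl

button-at : ∀ {r s} → s ≤ r → r < n → ∃[ b ] coords {n} b ≡ (suc r , suc s)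
button-at {n} {r} {s} s≤r r<n = (fromℕ< r<n , fromℕ< s<) ,
  cong₂ _,_ (cong suc (toℕ-fromℕ< r<n)) (cong suc (toℕ-fromℕ< s<))
  where
  s< : s < suc (toℕ (fromℕ< r<n))
  s< = subst (λ k → s < suc k) (sym (toℕ-fromℕ< r<n)) (s≤s s≤r)

allButtons-unique : ∀ n → Unique (allButtons n)
allButtons-unique n = Unique.concat⁺
  (All.map⁺ (All.tabulate⁺ λ i → Unique.map⁺ (λ { refl → refl }) (Unique.allFin⁺ (suc (toℕ i)))))
  (AllPairs.map⁺ (AllPairs.tabulate⁺ λ {i} {j} i≢j → disjoint i≢j))
  where
  disjoint : ∀ {i j : Fin n} → i ≢ j →
             Disjoint (map (i ,_) (allFin (suc (toℕ i)))) (map (j ,_) (allFin (suc (toℕ j))))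
  disjoint i≢j (b∈i , b∈j) with ∈-map⁻ _ b∈i | ∈-map⁻ _ b∈j
  ... | _ , _ , refl | _ , _ , refl = i≢j refl

∈-allButtons : ∀ (b : Button n) → b ∈ allButtons n
∈-allButtons (i , j) = ∈-concat⁺′ (∈-map⁺ (i ,_) (∈-allFin j)) (∈-map⁺ _ (∈-allFin i))

-- Extension by zero, written as a sum of point masses so that `presses≡⨁hexagon` can interchange it
-- with the sum over a hexagon.
extend : ButtonSet n → ℕ × ℕ → Bool
extend {n} X p = ⨁ (allButtons n) (λ b → X b ∧ does (coords b ≟-coords p))

extend-coords : ∀ (X : ButtonSet n) b → extend X (coords b) ≡ X b
extend-coords {n} X b = trans
  (⨁-single (allButtons-unique n) (∈-allButtons b) λ {c} c≢b →
    trans (cong (X c ∧_) (dec-false (coords c ≟-coords coords b) (c≢b ∘ coords-injective c b)))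
          (∧-zeroʳ (X c)))
  (trans (cong (X b ∧_) (dec-true (coords b ≟-coords coords b) refl)) (∧-identityʳ (X b)))

extend-outside : ∀ (X : ButtonSet n) {p} → (∀ b → coords b ≢ p) → extend X p ≡ false
extend-outside {n} X {p} outside = ⨁-zero (allButtons n) λ {b} _ →
  trans (cong (X b ∧_) (dec-false (coords b ≟-coords p) (outside b))) (∧-zeroʳ (X b))

-- Hexagons and the parity of presses

-- Centred at (1 + r , 1 + s), so that no subtraction occurs.
hexagon : ℕ → ℕ → List (ℕ × ℕ)
hexagon r s =
  (1 + r , 1 + s) ∷
  (1 + r , s) ∷ (1 + r , 2 + s) ∷
  (r , s) ∷ (r , 1 + s) ∷
  (2 + r , 1 + s) ∷ (2 + r , 2 + s) ∷ []

hexagon-coords : ∀ (b : Button n) → coords b ∷ adjacentCoords (coords b) ≡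
                 hexagon (toℕ (proj₁ b)) (toℕ (proj₂ b))
hexagon-coords (i , j) rewrite +-comm (toℕ i) 1 | +-comm (toℕ j) 1 = refl

-- The offsets are closed under negation: each position is sent to the opposite one.
hexagon-sym : ∀ {r s r′ s′} → (suc r′ , suc s′) ∈ hexagon r s → (suc r , suc s) ∈ hexagon r′ s′
hexagon-sym (here refl) = here refl
hexagon-sym (there (here refl)) = there (there (here refl))
hexagon-sym (there (there (here refl))) = there (here refl)
hexagon-sym (there (there (there (here refl)))) = there (there (there (there (there (there (here refl))))))
hexagon-sym (there (there (there (there (here refl))))) = there (there (there (there (there (here refl)))))
hexagon-sym (there (there (there (there (there (here refl)))))) = there (there (there (there (here refl))))
hexagon-sym (there (there (there (there (there (there (here refl))))))) = there (there (there (here refl)))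

hexagon-unique : ∀ r s → Unique (hexagon r s)
-- Every hexagon is a translate of `hexagon 0 0`, for which distinctness is decided by computation.
hexagon-unique r s = Unique.map⁺ translate-injective (from-yes (unique? _≟-coords_ (hexagon 0 0)))
  where
  translate : ℕ × ℕ → ℕ × ℕ
  translate (a , b) = a + r , b + s

  translate-injective : ∀ {p q} → translate p ≡ translate q → p ≡ q
  translate-injective eq with ,-injective eq
  ... | eq₁ , eq₂ = cong₂ _,_ (+-cancelʳ-≡ r _ _ eq₁) (+-cancelʳ-≡ s _ _ eq₂)

-- `Affects` is defined by the points around `b`, but the parity at `c` counts the presses around
-- `c`; symmetry moves the centre.
affects⇔∈hexagon : ∀ (b c : Button n) →
                   Affects b c ⇔ (coords b ∈ hexagon (toℕ (proj₁ c)) (toℕ (proj₂ c)))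
affects⇔∈hexagon b c = mk⇔ (hexagon-sym ∘ to) (from ∘ hexagon-sym)
  where
  Around : Set
  Around = coords c ∈ hexagon (toℕ (proj₁ b)) (toℕ (proj₂ b))

  to : Affects b c → Around
  to (inj₁ refl) = here refl
  to (inj₂ c∈)   = subst (coords c ∈_) (hexagon-coords b) (there c∈)

  from : Around → Affects b c
  from c∈ with subst (coords c ∈_) (sym (hexagon-coords b)) c∈
  ... | here eq   = inj₁ (coords-injective c b eq)
  ... | there c∈′ = inj₂ c∈′

-- Double counting: membership in the hexagon becomes a sum of equality indicators, and the two sums
-- are interchanged.
presses≡⨁hexagon : ∀ (X : ButtonSet n) c →
  ⨁ (allButtons n) (λ b → X b ∧ does (affects? b c)) ≡
  ⨁ (hexagon (toℕ (proj₁ c)) (toℕ (proj₂ c))) (extend X)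
presses≡⨁hexagon {n} X c = trans
  (⨁-cong (allButtons n) λ b → trans
    (cong (X b ∧_) (trans
      (does-⇔ (affects⇔∈hexagon b c) (affects? b c) (coords b ∈? around))
      (sym (⨁-∈? _≟-coords_ (hexagon-unique _ _) (coords b)))))
    (∧-distribˡ-⨁ (X b) around λ p → does (coords b ≟-coords p)))
  (⨁-swap (allButtons n) around λ b p → X b ∧ does (coords b ≟-coords p))
  where
  around : List (ℕ × ℕ)
  around = hexagon (toℕ (proj₁ c)) (toℕ (proj₂ c))

-- Triangle coordinates and harmonic functions

-- Coordinates in which the sides of the triangle of size n lie on u = 0,
-- v = 0 and u + v = n + 2, the button (r , s) being at u = s, v = r - s + 1.
at : ButtonSet n → ℕ → ℕ → Bool
at X u v = extend X (pred (u + v) , u)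

xor₇ : (a b c d e f g : Bool) → Bool
xor₇ a b c d e f g = a xor (b xor c xor d xor e xor f xor g)

xor₇-cong : ∀ {a b c d e f g a′ b′ c′ d′ e′ f′ g′} →
            a ≡ a′ → b ≡ b′ → c ≡ c′ → d ≡ d′ → e ≡ e′ → f ≡ f′ → g ≡ g′ →
            xor₇ a b c d e f g ≡ xor₇ a′ b′ c′ d′ e′ f′ g′
xor₇-cong refl refl refl refl refl refl refl = refl

module _ where
  open Bool.xor-∧-Solver

  -- The order in which a rotation of the barycentric coordinates visits the six neighbours.
  xor₇-rotate : ∀ a b c d e f g → xor₇ a g d f b c e ≡ xor₇ a b c d e f g
  xor₇-rotate = solve 7 (λ a b c d e f g →
    a :+ (g :+ (d :+ (f :+ (b :+ (c :+ e))))) := a :+ (b :+ (c :+ (d :+ (e :+ (f :+ g)))))) refl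

  -- The order in which the mirror map of `tile-down` visits the six neighbours.
  xor₇-reflect : ∀ a b c d e f g → xor₇ a e f d b c g ≡ xor₇ a b c d e f g
  xor₇-reflect = solve 7 (λ a b c d e f g →
    a :+ (e :+ (f :+ (d :+ (b :+ (c :+ g))))) := a :+ (b :+ (c :+ (d :+ (e :+ (f :+ g)))))) refl

-- Centred at (1 + p , 1 + q); in these coordinates the lattice neighbours are
-- at offsets ±(1 , 0), ±(0 , 1), ±(1 , -1).
hexSum : (ℕ → ℕ → Bool) → ℕ → ℕ → Bool
hexSum f p q = xor₇
  (f (1 + p) (1 + q))
  (f p (2 + q)) (f (2 + p) q)
  (f p (1 + q)) (f (1 + p) q)
  (f (1 + p) (2 + q)) (f (2 + p) (1 + q))

-- The centre has coordinate sum 2 + (p + q) and no neighbour exceeds it by more than 1; this lets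
-- functions that agree only up to a side of the triangle be exchanged.
hexSum-cong : ∀ {f g} p q → (∀ u v → u + v ≤ 3 + (p + q) → f u v ≡ g u v) →
              hexSum f p q ≡ hexSum g p q
hexSum-cong p q f≡g = xor₇-cong
  (f≡g (1 + p) (1 + q) (near₂ (sum₂ p q)))
  (f≡g p (2 + q) (near₂ (sum₃ p q)))
  (f≡g (2 + p) q (near₂ refl))
  (f≡g p (1 + q) (near₁ (+-suc p q)))
  (f≡g (1 + p) q (near₁ refl))
  (f≡g (1 + p) (2 + q) (≤-reflexive (cong suc (sum₃ p q))))
  (f≡g (2 + p) (1 + q) (≤-reflexive (cong suc (sum₂ p q))))
  where
  near₁ : ∀ {m} → m ≡ 1 + (p + q) → m ≤ 3 + (p + q)
  near₁ eq = ≤-trans (≤-reflexive eq) (m≤n+m (1 + (p + q)) 2)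
  near₂ : ∀ {m} → m ≡ 2 + (p + q) → m ≤ 3 + (p + q)
  near₂ eq = ≤-trans (≤-reflexive eq) (n≤1+n (2 + (p + q)))
  sum₂ : ∀ p q → (1 + p) + (1 + q) ≡ 2 + (p + q)
  sum₂ = solve-∀
  sum₃ : ∀ p q → p + (2 + q) ≡ 2 + (p + q)
  sum₃ = solve-∀

⨁hexagon≡hexSum : ∀ (X : ButtonSet n) p q → ⨁ (hexagon (p + q) p) (extend X) ≡ hexSum (at X) p q
⨁hexagon≡hexSum X p q
  rewrite +-suc p (suc q) | +-suc p q | xor-identityʳ (extend X (2 + (p + q) , 2 + p)) = refl

Harmonic : (ℕ → ℕ → Bool) → ℕ → Set
Harmonic f n = ∀ p q → p + q < n → hexSum f p q ≡ false

null⇒harmonic : ∀ {X : ButtonSet n} → IsNullSequence X → Harmonic (at X) n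
null⇒harmonic {n} {X} null p q p+q<n with button-at (m≤m+n p q) p+q<n
... | c , eq with ,-injective eq
...   | eq₁ , eq₂ = begin
  hexSum (at X) p q                                           ≡⟨ ⨁hexagon≡hexSum X p q ⟨
  ⨁ (hexagon (p + q) p) (extend X)                            ≡⟨ cong₂ (λ r s → ⨁ (hexagon r s) (extend X))
       (suc-injective eq₁) (suc-injective eq₂) ⟨
  ⨁ (hexagon (toℕ (proj₁ c)) (toℕ (proj₂ c))) (extend X)      ≡⟨ presses≡⨁hexagon X c ⟨
  -- The change is the same for every configuration, so the all-unlit one suffices to read it off.
  ⨁ (allButtons n) (λ b → X b ∧ does (affects? b c))          ≡⟨ pressAll-⨁ X (λ _ → false) c ⟨
  pressAll X (λ _ → false) c                                  ≡⟨ null (λ _ → false) c ⟩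
  false                                                       ∎
  where open ≡-Reasoning

harmonic⇒null : ∀ {X : ButtonSet n} → Harmonic (at X) n → IsNullSequence X
harmonic⇒null {n} {X} harmonic C c@(i , j) = trans (pressAll-⨁ X C c)
  (trans (cong (C c xor_) no-change) (xor-identityʳ (C c)))
  where
  open ≡-Reasoning
  r = toℕ i
  s = toℕ j

  i≡ : s + (r ∸ s) ≡ r
  i≡ = m+[n∸m]≡n (s≤s⁻¹ (toℕ<n j))

  no-change : ⨁ (allButtons n) (λ b → X b ∧ does (affects? b c)) ≡ false
  no-change = begin
    ⨁ (allButtons n) (λ b → X b ∧ does (affects? b c))    ≡⟨ presses≡⨁hexagon X c ⟩
    ⨁ (hexagon r s) (extend X)                            ≡⟨ cong (λ r → ⨁ (hexagon r s) (extend X)) i≡ ⟨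
    ⨁ (hexagon (s + (r ∸ s)) s) (extend X)                ≡⟨ ⨁hexagon≡hexSum X s (r ∸ s) ⟩
    hexSum (at X) s (r ∸ s)                               ≡⟨ harmonic _ _ (subst (_< n) (sym i≡) (toℕ<n i)) ⟩
    false                                                 ∎

-- Boundary values and filling a triangle

data Outside (n : ℕ) : ℕ → ℕ → Set where
  left  : ∀ {v} → Outside n 0 v
  right : ∀ {u} → Outside n u 0
  below : ∀ {u v} → u + v ≡ 2 + n → Outside n u v

-- In terms of (r , s) the sides read s = 0, s = r + 1 (or s = 0 at the corner) and r = n + 1; no
-- button satisfies any of these.
at-outside : ∀ (X : ButtonSet n) {u v} → Outside n u v → at X u v ≡ false
at-outside X (left {v}) = extend-outside X {pred v , 0} λ _ ()
at-outside {n} X (right {u}) = extend-outside X (absurd u)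
  where
  absurd : ∀ u (b : Button n) → coords b ≢ (pred (u + 0) , u)
  absurd _ (i , j) eq with ,-injective eq
  ... | eq₁ , refl =
    <-irrefl (sym eq₁) (subst (_< suc (toℕ i)) (sym (+-identityʳ (toℕ j))) (toℕ<n j))
at-outside {n} X (below {u} {v} u+v≡) = extend-outside X λ b@(i , j) eq →
  <-irrefl (suc-injective (trans (proj₁ (,-injective eq)) (cong pred u+v≡))) (toℕ<n i)

fill : (ℕ → ℕ → Bool) → ButtonSet n
fill f (i , j) = f (suc (toℕ j)) (suc (toℕ i ∸ toℕ j))

fill-at : ∀ f {r s} → s ≤ r → r < n → ∃[ b ] fill {n} f b ≡ f (suc s) (suc (r ∸ s))
fill-at f s≤r r<n with button-at s≤r r<n
... | b , eq with ,-injective eq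
...   | eq₁ , eq₂ = b , cong₂ (λ r s → f (suc s) (suc (r ∸ s))) (suc-injective eq₁) (suc-injective eq₂)

-- Inside the triangle there is a button to read, and on the sides both functions vanish. Beyond u +
-- v = n + 2 nothing is known of `f`, hence the bound.
at-fill : ∀ {f} → (∀ {u v} → Outside n u v → f u v ≡ false) →
          ∀ u v → u + v ≤ 2 + n → at (fill {n} f) u v ≡ f u v
at-fill {n} {f} f≡0 = at-fill′
  where
  Y : ButtonSet n
  Y = fill f

  on-boundary : ∀ {u v} → Outside n u v → at Y u v ≡ f u v
  on-boundary out = trans (at-outside Y out) (sym (f≡0 out))

  at-fill′ : ∀ u v → u + v ≤ 2 + n → at Y u v ≡ f u v
  at-fill′ zero    v       _ = on-boundary left
  at-fill′ (suc p) zero    _ = on-boundary right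
  at-fill′ (suc p) (suc q) u+v≤ with m≤n⇒m<n∨m≡n u+v≤
  ... | inj₂ u+v≡ = on-boundary (below u+v≡)
  ... | inj₁ u+v<
      with button-at (m≤m+n p q)
             (s≤s⁻¹ (s≤s⁻¹ (subst (_< 2 + n) (cong suc (+-suc p q)) u+v<)))
  ...   | b , eq with ,-injective eq
  ...     | eq₁ , eq₂ = begin
    extend Y (p + suc q , suc p)        ≡⟨ cong (λ r → extend Y (r , suc p)) (+-suc p q) ⟩
    extend Y (suc (p + q) , suc p)      ≡⟨ cong (extend Y) eq ⟨
    extend Y (coords b)                 ≡⟨ extend-coords Y b ⟩
    Y b                                 ≡⟨ cong₂ (λ r s → f (suc s) (suc (r ∸ s)))
                                             (suc-injective eq₁) (suc-injective eq₂) ⟩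
    f (suc p) (suc (p + q ∸ p))         ≡⟨ cong (f (suc p) ∘ suc) (m+n∸m≡n p q) ⟩
    f (suc p) (suc q)                   ∎
    where open ≡-Reasoning

-- Barycentric hexagons and rotations of the triangle

hexSum₃ : (ℕ → ℕ → ℕ → Bool) → ℕ → ℕ → ℕ → Bool
hexSum₃ g x y z = xor₇
  (g (1 + x) (1 + y) (1 + z))
  (g x (2 + y) (1 + z)) (g (2 + x) y (1 + z))
  (g x (1 + y) (2 + z)) (g (1 + x) y (2 + z))
  (g (1 + x) (2 + y) z) (g (2 + x) (1 + y) z)

module Unfold
  (N : ℕ) .{{_ : NonZero N}} (g : ℕ → ℕ → ℕ → Bool)
  (g-0₁ : ∀ y z → g 0 y z ≡ false)
  (g-0₂ : ∀ x z → g x 0 z ≡ false)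
  (g-0₃ : ∀ x y → g x y 0 ≡ false)
  (g-hex : ∀ x y z → 3 + (x + y + z) ≡ N → hexSum₃ g x y z ≡ false)
  where

  -- g rotated by k thirds of a full turn; G (3 + k) is definitionally G k.
  G : ℕ → ℕ → ℕ → ℕ → Bool
  G zero    x y z = g x y z
  G (suc k) x y z = G k y z x

  G-0₁ : ∀ k y z → G k 0 y z ≡ false
  G-0₂ : ∀ k x z → G k x 0 z ≡ false
  G-0₃ : ∀ k x y → G k x y 0 ≡ false
  G-0₁ zero    = g-0₁
  G-0₁ (suc k) y z = G-0₃ k y z
  G-0₂ zero    = g-0₂
  G-0₂ (suc k) x z = G-0₁ k z x
  G-0₃ zero    = g-0₃
  G-0₃ (suc k) x y = G-0₂ k y x

  G-hex : ∀ k x y z → 3 + (x + y + z) ≡ N → hexSum₃ (G k) x y z ≡ false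
  G-hex zero    x y z eq = g-hex x y z eq
  G-hex (suc k) x y z eq = trans
    (xor₇-rotate
      (G k (1 + y) (1 + z) (1 + x))
      (G k y (2 + z) (1 + x)) (G k (2 + y) z (1 + x))
      (G k y (1 + z) (2 + x)) (G k (1 + y) z (2 + x))
      (G k (1 + y) (2 + z) x) (G k (2 + y) (1 + z) x))
    (G-hex k y z x (trans (rotate x y z) eq))
    where
    rotate : ∀ x y z → 3 + (y + z + x) ≡ 3 + (x + y + z)
    rotate = solve-∀

  -- A rhombus glued from two mirror triangles

  -- The value at (x , y) of the rhombus 0 ≤ x , y ≤ N, glued from the triangle
  -- x + y ≤ N and its mirror image.  Truncated subtraction makes the first
  -- summand vanish in the second triangle and vice versa.
  tile : ℕ → ℕ → ℕ → Bool
  tile k x y = G k x y (N ∸ (x + y)) xor G (suc k) (x + y ∸ N) (N ∸ y) (N ∸ x)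

  complement : ∀ {m n} → m + n ≡ N → N ∸ m ≡ n
  complement {m} {n} eq = trans (cong (_∸ m) (sym eq)) (m+n∸m≡n m n)

  tile-up : ∀ k {x y z} → x + y + z ≡ N → tile k x y ≡ G k x y z
  tile-up k {x} {y} {z} eq = trans
    (cong₂ (λ a b → G k x y a xor G (suc k) b (N ∸ y) (N ∸ x))
      (complement {x + y} eq) (m≤n⇒m∸n≡0 (subst (x + y ≤_) eq (m≤m+n (x + y) z))))
    (trans (cong (G k x y z xor_) (G-0₁ (suc k) (N ∸ y) (N ∸ x))) (xor-identityʳ _))

  -- Reading `G (suc k)` at (t , y′ , x′) is reading `G k` at (y′ , x′ , t), the mirror image of (x
  -- , y) in the diagonal x + y = N.
  tile-down : ∀ k {x y t y′ x′} → x + y ≡ N + t → y + y′ ≡ N → x + x′ ≡ N →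
              tile k x y ≡ G (suc k) t y′ x′
  tile-down k {x} {y} {t} {y′} {x′} eq eqʸ eqˣ
    rewrite complement {y} eqʸ | complement {x} eqˣ | eq | m+n∸m≡n N t | m≤n⇒m∸n≡0 (m≤m+n N t)
    = cong (_xor G (suc k) t y′ x′) (G-0₃ k x y)

  tile-0ˡ : ∀ k {y} → y ≤ N → tile k 0 y ≡ false
  tile-0ˡ k {y} y≤N = trans (tile-up k (m+[n∸m]≡n y≤N)) (G-0₁ k y _)

  tile-0ʳ : ∀ k {x} → x ≤ N → tile k x 0 ≡ false
  tile-0ʳ k {x} x≤N = trans
    (tile-up k (trans (cong (_+ (N ∸ x)) (+-identityʳ x)) (m+[n∸m]≡n x≤N)))
    (G-0₂ k x _)

  tile-diagonal : ∀ k {x y} → x + y ≡ N → tile k x y ≡ false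
  tile-diagonal k {x} {y} eq = trans (tile-up k (trans (+-identityʳ (x + y)) eq)) (G-0₃ k x y)

  tile-Nˡ : ∀ k {y} → y ≤ N → tile k N y ≡ false
  tile-Nˡ k {y} y≤N = trans (tile-down k refl (m+[n∸m]≡n y≤N) (+-identityʳ N)) (G-0₃ (suc k) y _)

  tile-Nʳ : ∀ k {x} → x ≤ N → tile k x N ≡ false
  tile-Nʳ k {x} x≤N = trans
    (tile-down k (+-comm x N) (+-identityʳ N) (m+[n∸m]≡n x≤N))
    (G-0₂ (suc k) x _)

  -- Mirror symmetry in the side x = N: the points one step before it and one step beyond it, in the
  -- adjacent rhombus of index 2 + k, have the same value. `tile-reflectʳ` does this for y = N,
  -- where the index grows by 1.
  tile-reflectˡ : ∀ k {x y} → suc x ≡ N → y < N → tile k x (suc y) ≡ tile (2 + k) 1 y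
  tile-reflectˡ k {x} {y} eq y<N = trans
    (tile-down k (trans (+-suc x y) (cong (_+ y) eq)) (m+[n∸m]≡n y<N) (trans (+-comm x 1) eq))
    (sym (tile-up (2 + k) (m+[n∸m]≡n y<N)))

  tile-reflectʳ : ∀ k {x y} → suc y ≡ N → x < N → tile k (suc x) y ≡ tile (1 + k) x 1
  tile-reflectʳ k {x} {y} eq x<N = trans
    (tile-down k {t = x} (trans (+-comm (suc x) y) (trans (+-suc y x) (cong (_+ x) eq)))
      (trans (+-comm y 1) eq) (m+[n∸m]≡n x<N))
    (sym (tile-up (1 + k) (trans (cong (_+ (N ∸ suc x)) (+-comm x 1)) (m+[n∸m]≡n x<N))))

  tile-hex : ∀ k {x y} → 2 + x ≤ N → 2 + y ≤ N → hexSum (tile k) x y ≡ false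
  -- The centre lies in the first triangle, on the diagonal or in the mirror triangle.
  tile-hex k {x} {y} 2+x≤N 2+y≤N with <-cmp (2 + (x + y)) N
  ... | tri< lt _ _ with m≤n⇒∃[o]m+o≡n lt
  ...   | z , eq = trans
    (xor₇-cong
      (up (arith₀ x y z)) (up (arith₁ x y z)) (up (arith₂ x y z)) (up (arith₃ x y z))
      (up (arith₄ x y z)) (up (arith₅ x y z)) (up (arith₆ x y z)))
    (G-hex k x y z eq)
    where
    up : ∀ {x′ y′ z′} → x′ + y′ + z′ ≡ 3 + (x + y) + z → tile k x′ y′ ≡ G k x′ y′ z′
    up eq′ = tile-up k (trans eq′ eq)

    arith₀ : ∀ x y z → (1 + x) + (1 + y) + (1 + z) ≡ 3 + (x + y) + z
    arith₀ = solve-∀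
    arith₁ : ∀ x y z → x + (2 + y) + (1 + z) ≡ 3 + (x + y) + z
    arith₁ = solve-∀
    arith₂ : ∀ x y z → (2 + x) + y + (1 + z) ≡ 3 + (x + y) + z
    arith₂ = solve-∀
    arith₃ : ∀ x y z → x + (1 + y) + (2 + z) ≡ 3 + (x + y) + z
    arith₃ = solve-∀
    arith₄ : ∀ x y z → (1 + x) + y + (2 + z) ≡ 3 + (x + y) + z
    arith₄ = solve-∀
    arith₅ : ∀ x y z → (1 + x) + (2 + y) + z ≡ 3 + (x + y) + z
    arith₅ = solve-∀
    arith₆ : ∀ x y z → (2 + x) + (1 + y) + z ≡ 3 + (x + y) + z
    arith₆ = solve-∀
  tile-hex k {x} {y} 2+x≤N 2+y≤N | tri≈ _ eq _ = trans
    (xor₇-cong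
      (tile-diagonal k (trans (cong suc (+-suc x y)) eq))
      (tile-diagonal k (trans (trans (+-suc x (suc y)) (cong suc (+-suc x y))) eq))
      (tile-diagonal k eq)
      (tile-up k {z = 1} (trans (arith₁ x y) eq))
      (tile-up k {z = 1} (trans (arith₂ x y) eq))
      (tile-down k {1 + x} {2 + y} {1} {x} {1 + y}
        (trans (arith₃ x y) (cong (_+ 1) eq)) (trans (arith₄ x y) eq)
        (trans (cong suc (+-suc x y)) eq))
      (tile-down k {2 + x} {1 + y} {1} {1 + x} {y}
        (trans (arith₅ x y) (cong (_+ 1) eq)) (trans (arith₆ x y) eq) eq))
    -- The centre and two neighbours lie on the diagonal; the other four form two mirror pairs.
    (cancel (G k x (1 + y) 1) (G k (1 + x) y 1))
    where
    arith₁ : ∀ x y → x + (1 + y) + 1 ≡ 2 + (x + y)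
    arith₁ = solve-∀
    arith₂ : ∀ x y → (1 + x) + y + 1 ≡ 2 + (x + y)
    arith₂ = solve-∀
    arith₃ : ∀ x y → (1 + x) + (2 + y) ≡ 2 + (x + y) + 1
    arith₃ = solve-∀
    arith₄ : ∀ x y → (2 + y) + x ≡ 2 + (x + y)
    arith₄ = solve-∀
    arith₅ : ∀ x y → (2 + x) + (1 + y) ≡ 2 + (x + y) + 1
    arith₅ = solve-∀
    arith₆ : ∀ x y → (1 + y) + (1 + x) ≡ 2 + (x + y)
    arith₆ = solve-∀
    cancel : ∀ a b → xor₇ false false false a b a b ≡ false
    cancel false false = refl
    cancel false true  = refl
    cancel true  false = refl
    cancel true  true  = refl
  tile-hex k {x} {y} 2+x≤N 2+y≤N | tri> _ _ gt
    with m≤n⇒∃[o]m+o≡n gt | m≤n⇒∃[o]m+o≡n 2+x≤N | m≤n⇒∃[o]m+o≡n 2+y≤N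
  ... | t , eq | x′ , eqˣ | y′ , eqʸ = trans
    (xor₇-cong
      (down (trans (sumˣʸ₁ x y) (plus (1 + t) (sym (+-suc N t)))) (trans (arith₁ y y′) eqʸ) (trans (arith₁ x x′) eqˣ))
      (down (trans (sumˣʸ₂ x y) (plus (1 + t) (sym (+-suc N t)))) eqʸ (trans (arith₀ x x′) eqˣ))
      (down (plus (1 + t) (sym (+-suc N t))) (trans (arith₀ y y′) eqʸ) eqˣ)
      (down (suc-injective (trans (sumˣʸ₃ x y) (sym eq))) (trans (arith₁ y y′) eqʸ) (trans (arith₀ x x′) eqˣ))
      (down (suc-injective (sym eq)) (trans (arith₀ y y′) eqʸ) (trans (arith₁ x x′) eqˣ))
      (down (trans (sumˣʸ₄ x y) (trans (cong suc (sym eq)) (arith₂ N t))) eqʸ (trans (arith₁ x x′) eqˣ))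
      (down (trans (sumˣʸ₅ x y) (trans (cong suc (sym eq)) (arith₂ N t))) (trans (arith₁ y y′) eqʸ) eqˣ))
    (trans
      (xor₇-reflect
        (G (suc k) (1 + t) (1 + y′) (1 + x′))
        (G (suc k) t (2 + y′) (1 + x′)) (G (suc k) (2 + t) y′ (1 + x′))
        (G (suc k) t (1 + y′) (2 + x′)) (G (suc k) (1 + t) y′ (2 + x′))
        (G (suc k) (1 + t) (2 + y′) x′) (G (suc k) (2 + t) (1 + y′) x′))
      (G-hex (suc k) t y′ x′ sum))
    where
    down : ∀ {x y t y′ x′} → x + y ≡ N + t → y + y′ ≡ N → x + x′ ≡ N →
           tile k x y ≡ G (suc k) t y′ x′
    down = tile-down k

    plus : ∀ s → suc N + t ≡ N + s → 2 + (x + y) ≡ N + s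
    plus s eq′ = trans (sym eq) eq′

    arith₀ : ∀ x x′ → x + (2 + x′) ≡ 2 + x + x′
    arith₀ = solve-∀
    arith₁ : ∀ x x′ → (1 + x) + (1 + x′) ≡ 2 + x + x′
    arith₁ = solve-∀
    arith₂ : ∀ N t → suc (suc N + t) ≡ N + (2 + t)
    arith₂ = solve-∀
    sumˣʸ₁ : ∀ x y → (1 + x) + (1 + y) ≡ 2 + (x + y)
    sumˣʸ₁ = solve-∀
    sumˣʸ₂ : ∀ x y → x + (2 + y) ≡ 2 + (x + y)
    sumˣʸ₂ = solve-∀
    sumˣʸ₃ : ∀ x y → 1 + (x + (1 + y)) ≡ 2 + (x + y)
    sumˣʸ₃ = solve-∀
    sumˣʸ₄ : ∀ x y → (1 + x) + (2 + y) ≡ 3 + (x + y)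
    sumˣʸ₄ = solve-∀
    sumˣʸ₅ : ∀ x y → (2 + x) + (1 + y) ≡ 3 + (x + y)
    sumˣʸ₅ = solve-∀

    regroup₁ : ∀ t y′ x′ x y N → 3 + (t + y′ + x′) + (N + (x + y)) ≡ (suc N + t) + (2 + (x + y + x′ + y′))
    regroup₁ = solve-∀
    regroup₂ : ∀ x y x′ y′ → (2 + (x + y)) + (2 + (x + y + x′ + y′)) ≡ (2 + x + x′) + (2 + y + y′) + (x + y)
    regroup₂ = solve-∀

    sum : 3 + (t + y′ + x′) ≡ N
    -- Adding N + (x + y) to both sides allows `eq`, `eqˣ` and `eqʸ` to be combined without
    -- subtraction.
    sum = +-cancelʳ-≡ (N + (x + y)) _ _ (begin
      3 + (t + y′ + x′) + (N + (x + y))             ≡⟨ regroup₁ t y′ x′ x y N ⟩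
      (suc N + t) + (2 + (x + y + x′ + y′))         ≡⟨ cong (_+ (2 + (x + y + x′ + y′))) eq ⟩
      (2 + (x + y)) + (2 + (x + y + x′ + y′))       ≡⟨ regroup₂ x y x′ y′ ⟩
      (2 + x + x′) + (2 + y + y′) + (x + y)         ≡⟨ cong₂ (λ a b → a + b + (x + y)) eqˣ eqʸ ⟩
      N + N + (x + y)                               ≡⟨ +-assoc N N (x + y) ⟩
      N + (N + (x + y))                             ∎)
      where open ≡-Reasoning

  -- The reflected function on the quadrant

  -- Translating by (N , 0) or (0 , N) turns the reflected triangle by two
  -- thirds or one third of a full rotation.
  F : ℕ → ℕ → Bool
  F u v = tile (u / N * 2 + v / N) (u % N) (v % N)

  F-left : ∀ a v → F (a * N) v ≡ false
  F-left a v = trans (cong (λ x → tile (a * N / N * 2 + v / N) x (v % N)) (m*n%n≡0 a N))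
                     (tile-0ˡ (a * N / N * 2 + v / N) (m%n≤n v N))

  F-right : ∀ u b → F u (b * N) ≡ false
  F-right u b = trans (cong (tile (u / N * 2 + b * N / N) (u % N)) (m*n%n≡0 b N))
                      (tile-0ʳ (u / N * 2 + b * N / N) (m%n≤n u N))

  quotient : ∀ {x} a → x < N → (x + a * N) / N ≡ a
  quotient {x} a x<N = trans (+-distrib-/-∣ʳ x (n∣m*n a)) (cong₂ _+_ (m<n⇒m/n≡0 x<N) (m*n/n≡m a N))

  remainder : ∀ {x} a → x < N → (x + a * N) % N ≡ x
  remainder {x} a x<N = trans ([m+kn]%n≡m%n x a N) (m<n⇒m%n≡m x<N)

  -- On the far sides x = N and y = N the quotient in `F` already belongs to the next rhombus, but
  -- both descriptions vanish there. So one formula covers the closed rhombus.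
  F-tile : ∀ a b {x y} → x ≤ N → y ≤ N → F (x + a * N) (y + b * N) ≡ tile (a * 2 + b) x y
  F-tile a b {x} {y} x≤N y≤N with m≤n⇒m<n∨m≡n x≤N | m≤n⇒m<n∨m≡n y≤N
  ... | inj₂ refl | _         = trans (F-left (suc a) (y + b * N)) (sym (tile-Nˡ (a * 2 + b) y≤N))
  ... | inj₁ _    | inj₂ refl = trans (F-right (x + a * N) (suc b)) (sym (tile-Nʳ (a * 2 + b) x≤N))
  ... | inj₁ x<N  | inj₁ y<N
    rewrite quotient a x<N | quotient b y<N | remainder a x<N | remainder b y<N = refl

  F-below : ∀ {u v} c → u + v ≡ c * N → F u v ≡ false
  F-below {u} {v} c u+v≡ = go N∣
    where
    N∣ : N ∣ u % N + v % N
    N∣ = Equivalence.to (m%n≡0⇔n∣m _ N)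
           (trans (sym (%-distribˡ-+ u v N)) (trans (cong (_% N) u+v≡) (m*n%n≡0 c N)))

    k : ℕ
    k = u / N * 2 + v / N

    go : N ∣ u % N + v % N → F u v ≡ false
    -- The remainders add up to a multiple of N below 2 N: 0 at a corner of the rhombus, or N on its
    -- diagonal.
    go (divides 0 eq) = trans
      (cong (λ x → tile k x (v % N)) (m+n≡0⇒m≡0 (u % N) eq)) (tile-0ˡ k (m%n≤n v N))
    go (divides 1 eq) = tile-diagonal k (trans eq (*-identityˡ N))
    go (divides (suc (suc e)) eq) = ⊥-elim (<-irrefl eq (<-≤-trans
      (+-mono-< (m%n<n u N) (m%n<n v N))
      (+-monoʳ-≤ N (m≤m+n N (e * N)))))

  F-hex : ∀ p q → hexSum F p q ≡ false
  F-hex p q = subst₂ (λ p q → hexSum F p q ≡ false)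
    (sym (m≡m%n+[m/n]*n p N)) (sym (m≡m%n+[m/n]*n q N))
    (hex (p / N) (q / N) (m%n<n p N) (m%n<n q N))
    where
    hex : ∀ a b {x y} → x < N → y < N → hexSum F (x + a * N) (y + b * N) ≡ false
    -- The centre is (1 + x , 1 + y) relative to rhombus (a , b); `inj₂` says that it lies on a side
    -- shared with the next rhombus.
    hex a b {x} {y} x<N y<N with m≤n⇒m<n∨m≡n x<N | m≤n⇒m<n∨m≡n y<N
    ... | inj₁ 2+x≤N | inj₁ 2+y≤N = trans
      (xor₇-cong
        (F-tile a b x<N y<N) (F-tile a b x≤N 2+y≤N) (F-tile a b 2+x≤N y≤N)
        (F-tile a b x≤N y<N) (F-tile a b x<N y≤N)
        (F-tile a b x<N 2+y≤N) (F-tile a b 2+x≤N y<N))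
      (tile-hex (a * 2 + b) 2+x≤N 2+y≤N)
      where
      x≤N = <⇒≤ x<N
      y≤N = <⇒≤ y<N
    ... | inj₂ 1+x≡N | inj₁ 2+y≤N = trans
      (xor₇-cong
        (onSide (suc y + b * N))
        (trans (F-tile a b x≤N 2+y≤N) (tile-reflectˡ k 1+x≡N 2+y≤N))
        (beyond y≤N)
        (trans (F-tile a b x≤N y<N) (tile-reflectˡ k 1+x≡N y<N))
        (onSide (y + b * N))
        (onSide (2 + y + b * N))
        (beyond y<N))
      (cancel (tile (2 + k) 1 (suc y)) (tile (2 + k) 1 y))
      where
      k = a * 2 + b
      x≤N = <⇒≤ x<N
      y≤N = <⇒≤ y<N

      onSide : ∀ v → F (suc x + a * N) v ≡ false
      onSide v = trans (cong (λ m → F (m + a * N) v) 1+x≡N) (F-left (suc a) v)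

      beyond : ∀ {y} → y ≤ N → F (2 + x + a * N) (y + b * N) ≡ tile (2 + k) 1 y
      beyond {y} y≤N = trans (cong (λ m → F (suc (m + a * N)) (y + b * N)) 1+x≡N)
                             (F-tile (suc a) b (≤-trans (s≤s z≤n) x<N) y≤N)

      cancel : ∀ c d → xor₇ false c d d false false c ≡ false
      cancel false false = refl
      cancel false true  = refl
      cancel true  false = refl
      cancel true  true  = refl
    ... | inj₁ 2+x≤N | inj₂ 1+y≡N = trans
      (xor₇-cong
        (onSide (suc x + a * N))
        (beyond x≤N)
        (trans (F-tile a b 2+x≤N y≤N) (tile-reflectʳ k 1+y≡N 2+x≤N))
        (onSide (x + a * N))
        (trans (F-tile a b x<N y≤N) (tile-reflectʳ k 1+y≡N x<N))
        (beyond x<N)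
        (onSide (2 + x + a * N)))
      (cancel (tile (1 + k) x 1) (tile (1 + k) (suc x) 1))
      where
      k = a * 2 + b
      x≤N = <⇒≤ x<N
      y≤N = <⇒≤ y<N

      onSide : ∀ u → F u (suc y + b * N) ≡ false
      onSide u = trans (cong (λ m → F u (m + b * N)) 1+y≡N) (F-right u (suc b))

      beyond : ∀ {x} → x ≤ N → F (x + a * N) (2 + y + b * N) ≡ tile (1 + k) x 1
      beyond {x} x≤N = trans (cong (λ m → F (x + a * N) (suc (m + b * N))) 1+y≡N)
        (trans (F-tile a (suc b) x≤N (≤-trans (s≤s z≤n) y<N))
               (cong (λ k → tile k x 1) (+-suc (a * 2) b)))

      cancel : ∀ c d → xor₇ false c d false c d false ≡ false
      cancel false false = refl
      cancel false true  = refl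
      cancel true  false = refl
      cancel true  true  = refl
    -- Around a vertex all neighbours lie on mirror lines; those at offsets ±(1 , -1) need the
    -- family u + v ≡ 0.
    ... | inj₂ refl | inj₂ refl = xor₇-cong
        (F-left (suc a) (suc b * N))
        (F-below {x + a * N} {2 + x + b * N} (2 + (a + b)) (arith₁ x a b))
        (F-below {2 + x + a * N} {x + b * N} (2 + (a + b)) (arith₂ x a b))
        (F-right (x + a * N) (suc b)) (F-left (suc a) (x + b * N))
        (F-left (suc a) (2 + x + b * N)) (F-right (2 + x + a * N) (suc b))
      where
      arith₁ : ∀ x a b → (x + a * suc x) + (2 + (x + b * suc x)) ≡ (2 + (a + b)) * suc x
      arith₁ = solve-∀
      arith₂ : ∀ x a b → (2 + (x + a * suc x)) + (x + b * suc x) ≡ (2 + (a + b)) * suc x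
      arith₂ = solve-∀

  F-fundamental : ∀ {x y z} → x < N → y < N → x + y + z ≡ N → F x y ≡ g x y z
  F-fundamental {x} {y} x<N y<N eq = trans
    (cong₂ F (sym (+-identityʳ x)) (sym (+-identityʳ y)))
    (trans (F-tile 0 0 (<⇒≤ x<N) (<⇒≤ y<N)) (tile-up 0 eq))

-- The reflected extension of a null sequence

-- X in the barycentric coordinates x + y + z = n + 2 of the closed triangle.
barycentric : ButtonSet n → ℕ → ℕ → ℕ → Bool
barycentric X x y zero    = false
barycentric X x y (suc z) = at X x y

-- The clause for third coordinate 0 agrees with `at X` once the coordinates sum to n + 2, since the
-- point is then on the third side.
barycentric-at : ∀ (X : ButtonSet n) {x y} z → x + y + z ≡ 2 + n → barycentric X x y z ≡ at X x y
barycentric-at X {x} {y} zero    eq =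
  sym (at-outside X {x} {y} (below (trans (sym (+-identityʳ (x + y))) eq)))
barycentric-at X         (suc z) eq = refl

module Reflected {n} (X : ButtonSet n) (null : IsNullSequence X) where

  barycentric-0₁ : ∀ y z → barycentric X 0 y z ≡ false
  barycentric-0₁ y zero    = refl
  barycentric-0₁ y (suc z) = at-outside X {0} {y} left

  barycentric-0₂ : ∀ x z → barycentric X x 0 z ≡ false
  barycentric-0₂ x zero    = refl
  barycentric-0₂ x (suc z) = at-outside X {x} {0} right

  barycentric-hex : ∀ x y z → 3 + (x + y + z) ≡ 2 + n → hexSum₃ (barycentric X) x y z ≡ false
  barycentric-hex x y z eq = trans
    (xor₇-cong {at X (1 + x) (1 + y)} {at X x (2 + y)} {at X (2 + x) y} {at X x (1 + y)} {at X (1 + x) y}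
      refl refl refl refl refl
      -- Only these two neighbours can have third coordinate 0; the other values reduce to `at X` by
      -- definition.
      (barycentric-at X {1 + x} {2 + y} z (trans (sum₁ x y z) eq))
      (barycentric-at X {2 + x} {1 + y} z (trans (sum₂ x y z) eq)))
    (null⇒harmonic null x y
      (s≤s⁻¹ (s≤s⁻¹ (subst (3 + (x + y) ≤_) eq (m≤m+n (3 + (x + y)) z)))))
    where
    sum₁ : ∀ x y z → (1 + x) + (2 + y) + z ≡ 3 + (x + y + z)
    sum₁ = solve-∀
    sum₂ : ∀ x y z → (2 + x) + (1 + y) + z ≡ 3 + (x + y + z)
    sum₂ = solve-∀

  open Unfold (2 + n) (barycentric X) barycentric-0₁ barycentric-0₂ (λ _ _ → refl) barycentric-hex public

  -- The original triangle is the unreflected half of rhombus (0 , 0), so `X` survives in `F`; this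
  -- keeps the larger null sequence non-empty.
  F-button : ∀ b → F (suc (toℕ (proj₂ b))) (suc (toℕ (proj₁ b) ∸ toℕ (proj₂ b))) ≡ X b
  F-button b@(i , j) = begin
    F (suc s) (suc (r ∸ s))                       ≡⟨ F-fundamental (s≤s (s≤s (<⇒≤ s<n))) r∸s<N sum ⟩
    barycentric X (suc s) (suc (r ∸ s)) (n ∸ r)   ≡⟨ barycentric-at X {suc s} (n ∸ r) sum ⟩
    extend X (s + suc (r ∸ s) , suc s)            ≡⟨ cong (λ m → extend X (m , suc s))
                                                       (trans (+-suc s (r ∸ s)) (cong suc (m+[n∸m]≡n s≤r))) ⟩
    extend X (coords b)                           ≡⟨ extend-coords X b ⟩
    X b                                           ∎
    where
    open ≡-Reasoning
    r = toℕ i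
    s = toℕ j

    r<n : r < n
    r<n = toℕ<n i

    s≤r : s ≤ r
    s≤r = s≤s⁻¹ (toℕ<n j)

    s<n : s < n
    s<n = ≤-<-trans s≤r r<n

    r∸s<N : suc (r ∸ s) < 2 + n
    r∸s<N = s≤s (s≤s (≤-trans (m∸n≤m r s) (<⇒≤ r<n)))

    sum : suc s + suc (r ∸ s) + (n ∸ r) ≡ 2 + n
    sum = begin
      suc s + suc (r ∸ s) + (n ∸ r)     ≡⟨ cong (λ m → suc m + (n ∸ r)) (+-suc s (r ∸ s)) ⟩
      2 + (s + (r ∸ s)) + (n ∸ r)       ≡⟨ cong (λ m → 2 + m + (n ∸ r)) (m+[n∸m]≡n s≤r) ⟩
      2 + r + (n ∸ r)                   ≡⟨ cong (2 +_) (m+[n∸m]≡n (<⇒≤ r<n)) ⟩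
      2 + n                             ∎

-- Restriction to the larger triangle

theorem1 : (n : ℕ) → 1 ≤ n → NonTrivialKernel n →
    (j : ℕ) → 1 ≤ j → NonTrivialKernel (n + (n + 2) * j)
theorem1 n _ (X , null , b@(i , s) , Xb≡true) j _ =
  Y , harmonic⇒null {X = Y} Y-harmonic , Y-nonEmpty
  where
  open Reflected X null

  m : ℕ
  m = n + (n + 2) * j

  Y : ButtonSet m
  Y = fill F

  2+m≡ : ∀ n j → 2 + (n + (n + 2) * j) ≡ suc j * (2 + n)
  2+m≡ = solve-∀

  F-outside : ∀ {u v} → Outside m u v → F u v ≡ false
  F-outside (left {v})           = F-left 0 v
  F-outside (right {u})          = F-right u 0
  -- Since m + 2 = (j + 1)(n + 2), the third side of the larger triangle is itself a mirror line.
  F-outside (below {u} {v} u+v≡) = F-below {u} {v} (suc j) (trans u+v≡ (2+m≡ n j))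

  Y-harmonic : Harmonic (at Y) m
  Y-harmonic p q p+q<m = trans
    (hexSum-cong {at Y} {F} p q λ u v u+v≤ →
      -- From p + q < m the hexagon reaches at most u + v = m + 2, where `at Y` and `F` still agree.
      at-fill {f = F} F-outside u v (≤-trans u+v≤ (s≤s (s≤s p+q<m))))
    (F-hex p q)

  Y-nonEmpty : NonEmpty Y
  Y-nonEmpty = c , trans Yc≡ (trans (F-button b) Xb≡true)
    where
    filled : ∃[ c ] fill {m} F c ≡ F (suc (toℕ s)) (suc (toℕ i ∸ toℕ s))
    -- The witness is the button with the coordinates of `b`, which exists in the larger triangle
    -- because n ≤ m.
    filled = fill-at F (s≤s⁻¹ (toℕ<n s)) (<-≤-trans (toℕ<n i) (m≤m+n n ((n + 2) * j)))

    c : Button m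
    c = proj₁ filled

    Yc≡ : Y c ≡ F (suc (toℕ s)) (suc (toℕ i ∸ toℕ s))
    Yc≡ = proj₂ filled
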